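{- Let $\ell_1,\dots,\ell_r$ be positive integers. Let $\mathcal{U}$ be a cube partition of $\mathbb{N}$ of order $(\ell_1,\dots,\ell_r)$ with equally (upper-) dense partition classes, and let $c_{\mathcal{U}}$ be the cube colouring of $\vec{K}_{\mathbb{N}}$ on $\mathcal{U}$. Then for every $i\in\{1,\dots,r\}$ there is no directed path of length $\ell_i$ in colour $i$ (that is, with all edges of colour $i$), and every directed monochromatic path of colour $r+1$ has upper density at most $\prod_{i=1}^r\frac{1}{\ell_i}$.
   Context: $\mathbb{N}$ denotes the positive integers. $\vec{K}_{\mathbb{N}}$ is the complete symmetric digraph on $\mathbb{N}$: its edges are all ordered pairs $(m,n)$ of distinct positive integers. The upper density of $A\subseteq\mathbb{N}$ is $\bar d(A)=\limsup_{n\to\infty}\frac{|A\cap\{1,\dots,n\}|}{n}$, and the upper density of a path is that of its vertex set. "Equally (upper-) dense partition classes" means that all partition classes have the same (upper) density. A directed path is a finite or one-way infinite sequence of distinct vertices $v_1v_2\dots$ together with edges joining consecutive vertices, all oriented in the same direction (all edges $(v_i,v_{i+1})$, or all edges $(v_{i+1},v_i)$). The length of a path is its number of edges. Cube partition: a cube partition of $\mathbb{N}$ of order $(\ell_1,\dots,\ell_r)$ is a partition $\mathcal{U}=(U_{i_1,\dots,i_r})$ of $\mathbb{N}$ indexed by the tuples $(i_1,\dots,i_r)\in\prod_{k=1}^r\{0,\dots,\ell_k-1\}$. Cube colouring: for a cube partition $\mathcal{U}$, the colouring $c_{\mathcal{U}}\colon E(\vec{K}_{\mathbb{N}})\to\{1,\dots,r+1\}$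 is defined as follows. If $m\neq n$ lie in the same class of $\mathcal{U}$, then $(m,n)$ and $(n,m)$ both get colour $r+1$. If $m\in U_{i_1,\dots,i_r}$ and $n\in U_{j_1,\dots,j_r}$ lie in different classes, let $k=\min\{k'\in\{1,\dots,r\}: i_{k'}\neq j_{k'}\}$ and name $m,n$ so that $i_k<j_k$; then $(m,n)$ gets colour $r+1$ and $(n,m)$ gets colour $k$.
   Formalization: "Equally (upper-) dense" is taken to mean that all classes have a natural density, the same one; with only equal upper densities the claim fails, e.g. for two classes alternating on super-exponentially long intervals, each of upper density 1. -}

module Defs where

open import Data.Bool.Base using (if_then_else_)
open import Data.Fin.Base using (Fin; toℕ; fromℕ; inject₁)
open import Data.Fin.Properties using (all?; ¬∀⟶∃¬-smallest)
  renaming (_≟_ to _≟ᶠ_; _<?_ to _<?ᶠ_)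
open import Data.Integer.Base using (+_)
open import Data.Irrelevant using ([_])
open import Data.List.Base using (List; length)
open import Data.List.Relation.Unary.All using () renaming (All to Allᴸ)
open import Data.List.Relation.Unary.Unique.Propositional using (Unique)
open import Data.Nat.Base as ℕ using (ℕ; suc; NonZero)
open import Data.Nat.Properties using (1+n≢n)
open import Data.Product using (Σ; ∃; ∃-syntax; ∃!; _×_; _,_; proj₁)
open import Data.Rational.Base as ℚ using (ℚ; 0ℚ; 1ℚ; _/_)
open import Data.Refinement using (Refinement-syntax; value; _,_)
open import Data.Vec.Base using (Vec; foldr′; lookup; map)
open import Data.Vec.Membership.Propositional.Properties using (∈-lookup)
open import Data.Vec.Relation.Unary.All as All using (All)
open import Function.Definitions using (Injective)
open import Level using (0ℓ)
open import Relation.Binary.PropositionalEquality using (_≡_; _≢_; sym; trans; cong)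
open import Relation.Nullary.Decidable.Core using (does; yes; no)
open import Relation.Unary using (Pred; _∈_)

ℕ⁺ : Set
ℕ⁺ = [ n ∈ ℕ ∣ NonZero n ]

infix 4 _≤⁺_
_≤⁺_ : ℕ⁺ → ℕ⁺ → Set
m ≤⁺ n = value m ℕ.≤ value n

ratio : ℕ → ℕ⁺ → ℚ
ratio k (n , [ n≢0 ]) = _/_ (+ k) n {{n≢0}}

-- Density.  Subsets of ℕ⁺ are arbitrary predicates, so |A ∩ {1,…,n}| is
-- described by relations rather than computed.

∣_∩[1‥_]∣≥_ : Pred ℕ⁺ 0ℓ → ℕ⁺ → ℕ → Set
∣ A ∩[1‥ n ]∣≥ k =
  ∃[ xs ] Unique xs × Allᴸ (λ m → m ∈ A × m ≤⁺ n) xs × length xs ≡ k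

∣_∩[1‥_]∣≡_ : Pred ℕ⁺ 0ℓ → ℕ⁺ → ℕ → Set
∣ A ∩[1‥ n ]∣≡ k =
  (∣ A ∩[1‥ n ]∣≥ k) × (∀ j → ∣ A ∩[1‥ n ]∣≥ j → j ℕ.≤ k)

record ℝ : Set where
  field
    approx : ℕ⁺ → ℚ
    cauchy : ∀ ε → 0ℚ ℚ.< ε → ∃[ N ] (∀ m n → N ≤⁺ m → N ≤⁺ n →
             ℚ.∣ approx m ℚ.- approx n ∣ ℚ.< ε)

-- Since approx d converges to d, the condition below says that
-- |A ∩ {1,…,n}| / n converges to d.
HasDensity : Pred ℕ⁺ 0ℓ → ℝ → Set
HasDensity A d =
  ∀ ε → 0ℚ ℚ.< ε → ∃[ N ] (∀ n → N ≤⁺ n → ∀ k → ∣ A ∩[1‥ n ]∣≡ k →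
  ℚ.∣ ratio k n ℚ.- ℝ.approx d n ∣ ℚ.< ε)

-- The limit superior of a sequence is the supremum of the rationals that the
-- sequence exceeds infinitely often; a set of rationals stands for its
-- supremum.
UpperDensity : Pred ℕ⁺ 0ℓ → Pred ℚ 0ℓ
UpperDensity A q =
  ∀ N → ∃[ n ] N ≤⁺ n × ∃[ k ] (∣ A ∩[1‥ n ]∣≥ k) × q ℚ.< ratio k n

_AtMost_ : Pred ℚ 0ℓ → ℚ → Set
L AtMost c = ∀ q → q ∈ L → q ℚ.≤ c

∏1/_ : ∀ {r} → Vec ℕ⁺ r → ℚ
∏1/ ℓ = foldr′ ℚ._*_ 1ℚ (map (ratio 1) ℓ)

Index : ∀ {r} → Vec ℕ⁺ r → Set
Index ℓ = All (λ l → Fin (value l)) ℓ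

_at_ : ∀ {r} {ℓ : Vec ℕ⁺ r} → Index ℓ → (k : Fin r) → Fin (value (lookup ℓ k))
_at_ {ℓ = ℓ} i k = All.lookup i (∈-lookup k ℓ)

record CubePartition {r} (ℓ : Vec ℕ⁺ r) : Set₁ where
  field
    U         : Index ℓ → Pred ℕ⁺ 0ℓ
    partition : ∀ n → ∃! _≡_ (λ i → n ∈ U i)

  indexOf : ℕ⁺ → Index ℓ
  indexOf n = proj₁ (partition n)

-- All classes have a natural density, the same one.  Having the same upper
-- density would not be enough to bound it: two complementary sets can both
-- have upper density 1.
EquallyDense : ∀ {r} {ℓ : Vec ℕ⁺ r} → CubePartition ℓ → Set
EquallyDense 𝒰 = Σ ℝ λ d → ∀ i → HasDensity (CubePartition.U 𝒰 i) d

record Edge : Set where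
  constructor edge
  field
    tail head : ℕ⁺
    distinct  : tail ≢ head

Colouring : ℕ → Set
Colouring c = Edge → Fin c

-- The colour of an edge from class i to class j.  Colours are counted from 0:
-- colour k ∈ {1,…,r} is inject₁ of the corresponding element of Fin r, and
-- colour r+1 is fromℕ r.
indexColour : ∀ {r} {ℓ : Vec ℕ⁺ r} → Index ℓ → Index ℓ → Fin (suc r)
indexColour {r} i j with all? (λ k → (i at k) ≟ᶠ (j at k))
... | yes _  = fromℕ r
... | no i≠j =
  let k , _ = ¬∀⟶∃¬-smallest r _ (λ k → (i at k) ≟ᶠ (j at k)) i≠j
  in if does ((i at k) <?ᶠ (j at k)) then fromℕ r else inject₁ k

cubeColouring : ∀ {r} {ℓ : Vec ℕ⁺ r} → CubePartition ℓ → Colouring (suc r)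
cubeColouring 𝒰 (edge m n _) = indexColour (indexOf m) (indexOf n)
  where open CubePartition 𝒰

data Length : Set where
  finite   : ℕ → Length
  infinite : Length

-- A path with n edges has n + 1 vertices.
Position : Length → Set
Position (finite n) = Fin (suc n)
Position infinite   = ℕ

position : ∀ {len} → Position len → ℕ
position {finite n} = toℕ
position {infinite} = λ i → i

data Orientation : Set where
  forward backward : Orientation

record DirectedPath (len : Length) : Set where
  field
    vertex      : Position len → ℕ⁺
    injective   : Injective _≡_ _≡_ vertex
    orientation : Orientation

  vertexSet : Pred ℕ⁺ 0ℓ
  vertexSet n = ∃[ i ] vertex i ≡ n

  Consecutive : Position len → Position len → Set
  Consecutive i j = position j ≡ suc (position i)

  consecutive⇒≢ : ∀ {i j} → Consecutive i j → vertex i ≢ vertex j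
  consecutive⇒≢ j≡1+i vᵢ≡vⱼ =
    1+n≢n (trans (sym j≡1+i) (cong position (sym (injective vᵢ≡vⱼ))))

  edgeBetween : ∀ i j → Consecutive i j → Edge
  edgeBetween i j i→j with orientation
  ... | forward  = edge (vertex i) (vertex j) (consecutive⇒≢ i→j)
  ... | backward = edge (vertex j) (vertex i) (λ eq → consecutive⇒≢ i→j (sym eq))

Monochromatic : ∀ {c len} → Colouring c → Fin c → DirectedPath len → Set
Monochromatic χ a p = ∀ i j (i→j : Consecutive i j) → χ (edgeBetween i j i→j) ≡ a
  where open DirectedPath p

{-# OPTIONS --safe #-}

-- Ordering the index tuples lexicographically, an edge of colour r+1 never
-- decreases the index, while an edge of colour k strictly decreases its k-th
-- coordinate, which takes only ℓ_k values.  Hence along an infinite path of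
-- colour r+1 the index is eventually constant, so the path is contained in one
-- class up to finitely many vertices.  By the pigeonhole principle some class
-- has at most n / ∏ ℓ elements in {1,…,n}, and for large n all classes have
-- almost the same number of elements there.  Eventual constancy is only
-- available up to double negation, which suffices because ≤ on ℚ is decidable.
module Submission where

open import Defs
import Algebra.Properties.CommutativeMonoid.Sum as Sums
open import Data.Bool.Base using (if_then_else_; true; false)
open import Data.Empty using (⊥; ⊥-elim)
open import Data.Fin.Base as Fin using (Fin; zero; suc; toℕ; fromℕ; inject₁; combine; remQuot)
import Data.Fin.Induction as Fin
import Data.Fin.Properties as Fin
open import Data.Integer.Base as ℤ using (+_; +[1+_])
import Data.Integer.Properties as ℤ
open import Data.Irrelevant using ([_])
open import Data.List.Base using (List; []; _∷_; _++_; allFin; filter; length; upTo)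
  renaming (lookup to lookupᴸ; map to mapᴸ)
open import Data.List.Extrema.Nat using (argmax; argmin; f[argmin]≤f[xs]; f[xs]≤f[argmax])
open import Data.List.Membership.Propositional.Properties
  using (∈-allFin; ∈-++⁺ˡ; ∈-++⁺ʳ; ∈-filter⁺; ∈-filter⁻; ∈-lookup; ∈-map⁺; ∈-map⁻; ∈-upTo⁺; ∈-upTo⁻)
open import Data.List.Membership.Propositional using () renaming (_∈_ to _∈ᴸ_)
open import Data.List.Properties using (length-++; length-map; length-upTo)
open import Data.List.Relation.Binary.Subset.Propositional using (_⊆_)
import Data.List.Relation.Unary.All as Allᴸ
import Data.List.Relation.Unary.AllPairs as AllPairs
open import Data.List.Relation.Unary.Any using (index)
open import Data.List.Relation.Unary.Any.Properties using (lookup-index)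
open import Data.List.Relation.Unary.Unique.Propositional using (Unique)
import Data.List.Relation.Unary.Unique.Propositional.Properties as Unique
open import Data.Nat.Base as ℕ using (ℕ; zero; suc; NonZero; z≤n; s≤s; _⊔_)
import Data.Nat.Properties as ℕ
open import Data.Product using (∃₂; ∃-syntax; _×_; _,_; proj₁; proj₂)
open import Data.Rational.Base as ℚ using (0ℚ; mkℚ)
import Data.Rational.Properties as ℚ
open import Data.Rational.Solver using (module +-*-Solver)
open import Data.Rational.Unnormalised.Base as ℚᵘ using (mkℚᵘ)
import Data.Rational.Unnormalised.Properties as ℚᵘ
open import Data.Refinement using (value; _,_)
open import Data.Sum.Base as Sum using (_⊎_; inj₁; inj₂; [_,_]′)
open import Data.Vec.Base using (Vec; []; _∷_; lookup)
open import Data.Vec.Relation.Unary.All using ([]; _∷_)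
open import Function.Base using (_∘_)
open import Induction.WellFounded using (Acc; acc; WellFounded)
open import Level using (0ℓ)
open import Relation.Binary.Core using (Rel)
open import Relation.Binary.Definitions using (Transitive; Irreflexive)
open import Relation.Binary.PropositionalEquality
  using (_≡_; refl; sym; trans; cong; cong₂; subst; subst₂; module ≡-Reasoning)
open import Relation.Nullary.Decidable using (Dec; does; yes; no; decidable-stable)
open import Relation.Nullary.Negation using (¬_; contradiction)
open import Relation.Unary using (Pred; _∈_)

-- Lists and finite sums

lookup-injective : ∀ {A : Set} {xs : List A} → Unique xs →
                   ∀ i j → lookupᴸ xs i ≡ lookupᴸ xs j → i ≡ j
lookup-injective (_ AllPairs.∷ _) zero zero _ = refl
lookup-injective (x∉xs AllPairs.∷ _) zero (suc j) eq =
  contradiction eq (Allᴸ.lookup x∉xs (∈-lookup j))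
lookup-injective (x∉xs AllPairs.∷ _) (suc i) zero eq =
  contradiction (sym eq) (Allᴸ.lookup x∉xs (∈-lookup i))
lookup-injective (_ AllPairs.∷ xs!) (suc i) (suc j) eq = cong suc (lookup-injective xs! i j eq)

-- Equality on `A` need not be decidable, so the injection is built between positions: each
-- membership proof in `ys` carries an index, and equal indices force equal elements of `xs`.
Unique-⊆⇒length-≤ : ∀ {A : Set} {xs ys : List A} → Unique xs → xs ⊆ ys → length xs ℕ.≤ length ys
Unique-⊆⇒length-≤ {xs = xs} {ys} xs! xs⊆ys = Fin.injective⇒≤ injective
  where
  position-in-ys : Fin (length xs) → Fin (length ys)
  position-in-ys i = index (xs⊆ys (∈-lookup i))

  injective : ∀ {i j} → position-in-ys i ≡ position-in-ys j → i ≡ j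
  injective {i} {j} eq = lookup-injective xs! i j (begin
    lookupᴸ xs i                   ≡⟨ lookup-index (xs⊆ys (∈-lookup i)) ⟩
    lookupᴸ ys (position-in-ys i)  ≡⟨ cong (lookupᴸ ys) eq ⟩
    lookupᴸ ys (position-in-ys j)  ≡⟨ lookup-index (xs⊆ys (∈-lookup j)) ⟨
    lookupᴸ xs j                   ∎)
    where open ≡-Reasoning

module ∑ = Sums ℕ.+-0-commutativeMonoid
open ∑ using (sum)

∑-≥ : ∀ {n} (f : Fin n → ℕ) {k} → (∀ i → k ℕ.≤ f i) → n ℕ.* k ℕ.≤ sum f
∑-≥ {zero}  f k≤f = z≤n
∑-≥ {suc n} f k≤f = ℕ.+-mono-≤ (k≤f zero) (∑-≥ (f ∘ suc) (k≤f ∘ suc))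

∃-minimiser : ∀ {n} .{{_ : NonZero n}} (f : Fin n → ℕ) → ∃[ i ] (∀ j → f i ℕ.≤ f j)
∃-minimiser {suc n} f = argmin f zero (allFin _) ,
  λ j → Allᴸ.lookup (f[argmin]≤f[xs] {f = f} zero (allFin _)) (∈-allFin j)

∃-upperBound : ∀ {n} (f : Fin n → ℕ) → ∃[ N ] (∀ i → f i ℕ.≤ N)
∃-upperBound {zero}  f = 0 , λ ()
∃-upperBound {suc n} f = f (argmax f zero (allFin _)) ,
  λ j → Allᴸ.lookup (f[xs]≤f[argmax] {f = f} zero (allFin _)) (∈-allFin j)

-- Fibres of a map into a finite set.

indicator : ∀ {n} → Fin n → Fin n → ℕ
indicator i j = if does (i Fin.≟ j) then 1 else 0

∑-indicator : ∀ {n} (i : Fin n) → sum (indicator i) ≡ 1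
∑-indicator {suc n} zero    = cong suc (∑.sum-replicate-zero n)
∑-indicator {suc n} (suc i) = ∑-indicator i

module _ {A : Set} {n} (f : A → Fin n) where

  fibre : List A → Fin n → List A
  fibre xs i = filter (λ x → f x Fin.≟ i) xs

  length-fibre-∷ : ∀ x xs i → length (fibre (x ∷ xs) i) ≡ indicator (f x) i ℕ.+ length (fibre xs i)
  length-fibre-∷ x xs i with does (f x Fin.≟ i)
  ... | true  = refl
  ... | false = refl

  ∑-length-fibre : ∀ xs → sum (λ i → length (fibre xs i)) ≡ length xs
  ∑-length-fibre []       = ∑.sum-replicate-zero n
  ∑-length-fibre (x ∷ xs) = begin
    sum (λ i → length (fibre (x ∷ xs) i))                       ≡⟨ ∑.sum-cong-≗ (length-fibre-∷ x xs) ⟩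
    sum (λ i → indicator (f x) i ℕ.+ length (fibre xs i))       ≡⟨ ∑.∑-distrib-+ (indicator (f x)) _ ⟩
    sum (indicator (f x)) ℕ.+ sum (λ i → length (fibre xs i))   ≡⟨ cong₂ ℕ._+_ (∑-indicator (f x)) (∑-length-fibre xs) ⟩
    suc (length xs)                                             ∎
    where open ≡-Reasoning

  -- The fibre lengths add up to the length of the list, so the shortest is at most their average.
  ∃-small-fibre : .{{_ : NonZero n}} → ∀ xs → ∃[ i ] n ℕ.* length (fibre xs i) ℕ.≤ length xs
  ∃-small-fibre xs with i , i-minimal ← ∃-minimiser (λ i → length (fibre xs i)) =
    i , ℕ.≤-trans (∑-≥ _ i-minimal) (ℕ.≤-reflexive (∑-length-fibre xs))

-- Monotone sequences

module _ {A : Set} {_∼_ : Rel A 0ℓ} (∼-trans : Transitive _∼_) where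

  consecutive⇒monotone : ∀ {n} (x : Fin n → A) →
                         (∀ i j → toℕ j ≡ suc (toℕ i) → x i ∼ x j) → ∀ {i j} → i Fin.< j → x i ∼ x j
  consecutive⇒monotone x step {zero}  {suc zero}    _         = step zero (suc zero) refl
  consecutive⇒monotone x step {zero}  {suc (suc j)} _         =
    ∼-trans (step zero (suc zero) refl)
            (consecutive⇒monotone (x ∘ suc) (λ i j eq → step (suc i) (suc j) (cong suc eq)) {zero} {suc j} ℕ.z<s)
  consecutive⇒monotone x step {suc i} {suc j}       (s≤s i<j) =
    consecutive⇒monotone (x ∘ suc) (λ i j eq → step (suc i) (suc j) (cong suc eq)) i<j

-- By pigeonhole two of the `suc n` values coincide, and transitivity would relate that value to
-- itself.
no-long-chain : ∀ {n} (_∼_ : Rel (Fin n) 0ℓ) → Transitive _∼_ → Irreflexive _≡_ _∼_ →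
                (x : Fin (suc n) → Fin n) → ¬ (∀ i j → toℕ j ≡ suc (toℕ i) → x i ∼ x j)
no-long-chain _ ∼-trans ∼-irrefl x step with i , j , i<j , eq ← Fin.pigeonhole ℕ.≤-refl x =
  ∼-irrefl eq (consecutive⇒monotone (λ {a} {b} {c} → ∼-trans {a} {b} {c}) x step i<j)

module _ {A : Set} {_∼_ : Rel A 0ℓ} (∼-wf : WellFounded _∼_) (x : ℕ → A)
         (step : ∀ n → x (suc n) ≡ x n ⊎ x (suc n) ∼ x n) where

  -- Well-founded induction on `x m`: a strict step after `m` leads to a smaller value, already
  -- refuted by induction, so the sequence is constant from `m` on, against the assumption.
  ¬¬-eventuallyConstant : ¬ ¬ (∃[ m ] (∀ d → x (d ℕ.+ m) ≡ x m))
  ¬¬-eventuallyConstant ¬constant = descend 0 (∼-wf (x 0))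
    where
    descend : ∀ m → Acc _∼_ (x m) → ⊥
    descend m (acc rec) = ¬constant (m , constant)
      where
      constant : ∀ d → x (d ℕ.+ m) ≡ x m
      constant zero    = refl
      constant (suc d) with step (d ℕ.+ m)
      ... | inj₁ eq  = trans eq (constant d)
      -- Constancy up to `d` makes this a drop below `x m` itself, so the induction hypothesis
      -- applies.
      ... | inj₂ lt  = ⊥-elim (descend (suc d ℕ.+ m) (rec (subst (x (suc d ℕ.+ m) ∼_) (constant d) lt)))

-- Ratios

value-nonZero : (n : ℕ⁺) → NonZero (value n)
value-nonZero (n , [ n≢0 ]) = ℕ.≢-nonZero (ℕ.≢-nonZero⁻¹ n {{n≢0}})

infixl 7 _*⁺_
_*⁺_ : ℕ⁺ → ℕ⁺ → ℕ⁺
(m , [ m≢0 ]) *⁺ (n , [ n≢0 ]) = m ℕ.* n , [ ℕ.m*n≢0 m n {{m≢0}} {{n≢0}} ]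

-- `ratio` reduces to lowest terms. Unnormalised fractions keep numerator and denominator, so there
-- order and equality are plain cross-multiplication.
toℚᵘ-ratio : ∀ k n .(n≢0 : NonZero (suc n)) → ℚ.toℚᵘ (ratio k (suc n , [ n≢0 ])) ℚᵘ.≃ mkℚᵘ (+ k) n
toℚᵘ-ratio k n _ = ℚ.toℚᵘ-fromℚᵘ (mkℚᵘ (+ k) n)

ratio-≤ : ∀ j k m n → j ℕ.* value n ℕ.≤ k ℕ.* value m → ratio j m ℚ.≤ ratio k n
ratio-≤ j k (zero  , [ () ]) n j*n≤k*m
ratio-≤ j k (suc m , [ _ ]) (zero  , [ () ]) j*n≤k*m
ratio-≤ j k (suc m , [ m≢0 ]) (suc n , [ n≢0 ]) j*n≤k*m = ℚ.toℚᵘ-cancel-≤ (begin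
  ℚ.toℚᵘ (ratio j (suc m , [ m≢0 ]))  ≃⟨ toℚᵘ-ratio j m m≢0 ⟩
  mkℚᵘ (+ j) m                        ≤⟨ ℚᵘ.*≤* (subst₂ ℤ._≤_ (ℤ.pos-* j (suc n)) (ℤ.pos-* k (suc m)) (ℤ.+≤+ j*n≤k*m)) ⟩
  mkℚᵘ (+ k) n                        ≃⟨ toℚᵘ-ratio k n n≢0 ⟨
  ℚ.toℚᵘ (ratio k (suc n , [ n≢0 ]))  ∎)
  where open ℚᵘ.≤-Reasoning

ratio-monoˡ-≤ : ∀ {j k} n → j ℕ.≤ k → ratio j n ℚ.≤ ratio k n
ratio-monoˡ-≤ {j} {k} n j≤k = ratio-≤ j k n n (ℕ.*-monoˡ-≤ (value n) j≤k)

ratio-+ : ∀ j k n → ratio (j ℕ.+ k) n ≡ ratio j n ℚ.+ ratio k n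
ratio-+ j k (zero  , [ () ])
ratio-+ j k (suc n , [ n≢0 ]) = ℚ.toℚᵘ-injective (begin
  ℚ.toℚᵘ (ratio (j ℕ.+ k) _)                    ≈⟨ toℚᵘ-ratio (j ℕ.+ k) n n≢0 ⟩
  mkℚᵘ (+ (j ℕ.+ k)) n                          ≈⟨ ℚᵘ.*≡* (trans (sym (ℤ.*-assoc (+ (j ℕ.+ k)) N N))
                                                          (cong (ℤ._* N) (ℤ.*-distribʳ-+ N (+ j) (+ k)))) ⟩
  mkℚᵘ (+ j) n ℚᵘ.+ mkℚᵘ (+ k) n                ≈⟨ ℚᵘ.+-cong (toℚᵘ-ratio j n n≢0) (toℚᵘ-ratio k n n≢0) ⟨
  ℚ.toℚᵘ (ratio j _) ℚᵘ.+ ℚ.toℚᵘ (ratio k _)    ≈⟨ ℚ.toℚᵘ-homo-+ (ratio j _) (ratio k _) ⟨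
  ℚ.toℚᵘ (ratio j _ ℚ.+ ratio k _)              ∎)
  where
  N = + suc n
  open import Relation.Binary.Reasoning.Setoid ℚᵘ.≃-setoid

ratio-* : ∀ j k m n → ratio j m ℚ.* ratio k n ≡ ratio (j ℕ.* k) (m *⁺ n)
ratio-* j k (zero  , [ () ]) n
ratio-* j k (suc m , [ _ ]) (zero  , [ () ])
ratio-* j k (suc m , [ m≢0 ]) (suc n , [ n≢0 ]) = ℚ.toℚᵘ-injective (begin
  ℚ.toℚᵘ (ratio j _ ℚ.* ratio k _)              ≈⟨ ℚ.toℚᵘ-homo-* (ratio j _) (ratio k _) ⟩
  ℚ.toℚᵘ (ratio j _) ℚᵘ.* ℚ.toℚᵘ (ratio k _)    ≈⟨ ℚᵘ.*-cong (toℚᵘ-ratio j m m≢0) (toℚᵘ-ratio k n n≢0) ⟩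
  mkℚᵘ (+ j) m ℚᵘ.* mkℚᵘ (+ k) n                ≈⟨ ℚᵘ.*≡* (cong (ℤ._* (+ (suc m ℕ.* suc n))) (sym (ℤ.pos-* j k))) ⟩
  mkℚᵘ (+ (j ℕ.* k)) (n ℕ.+ m ℕ.* suc n)        ≈⟨ toℚᵘ-ratio (j ℕ.* k) (n ℕ.+ m ℕ.* suc n) _ ⟨
  ℚ.toℚᵘ (ratio (j ℕ.* k) _)                    ∎)
  where open import Relation.Binary.Reasoning.Setoid ℚᵘ.≃-setoid

ratio-eventually-< : ∀ k {ε} → 0ℚ ℚ.< ε → ∃[ N ] (∀ n → N ℕ.≤ value n → ratio k n ℚ.< ε)
ratio-eventually-< k {mkℚ (+ 0)        d _} (ℚ.*<* (ℤ.+<+ ()))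
ratio-eventually-< k {mkℚ (ℤ.-[1+ _ ]) d _} (ℚ.*<* ())
-- Here ε is `suc p` over `suc d`: past this threshold `k ℕ.* suc d` is less than `n`, hence less
-- than `suc p` times `n`.
ratio-eventually-< k {ε@(mkℚ +[1+ p ] d _)} _ = suc (k ℕ.* suc d) , λ
  { (zero  , [ () ])
  ; (suc n , [ n≢0 ]) k*d<n → ℚ.toℚᵘ-cancel-< (begin-strict
      ℚ.toℚᵘ (ratio k _)  ≃⟨ toℚᵘ-ratio k n n≢0 ⟩
      mkℚᵘ (+ k) n        <⟨ ℚᵘ.*<* (subst₂ ℤ._<_ (ℤ.pos-* k (suc d)) (ℤ.pos-* (suc p) (suc n))
                               (ℤ.+<+ (ℕ.<-≤-trans k*d<n (ℕ.m≤m+n (suc n) (p ℕ.* suc n))))) ⟩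
      ℚ.toℚᵘ ε            ∎)
  }
  where open ℚᵘ.≤-Reasoning

-- Estimates with absolute values.

∣p-q∣<ε⇒p<ε+q : ∀ {p q ε} → ℚ.∣ p ℚ.- q ∣ ℚ.< ε → p ℚ.< ε ℚ.+ q
∣p-q∣<ε⇒p<ε+q {p} {q} {ε} ∣p-q∣<ε = begin-strict
  p                     ≡⟨ +-*-Solver.solve 2 (λ p q → p := p :- q :+ q) refl p q ⟩
  p ℚ.- q ℚ.+ q         ≤⟨ ℚ.+-monoˡ-≤ q (p≤∣p∣ (p ℚ.- q)) ⟩
  ℚ.∣ p ℚ.- q ∣ ℚ.+ q   <⟨ ℚ.+-monoˡ-< q ∣p-q∣<ε ⟩
  ε ℚ.+ q               ∎
  where
  open ℚ.≤-Reasoning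
  open +-*-Solver using (_:=_; _:+_; _:-_)
  p≤∣p∣ : ∀ p → p ℚ.≤ ℚ.∣ p ∣
  p≤∣p∣ p with ℚ.≤-total 0ℚ p
  ... | inj₁ 0≤p = ℚ.≤-reflexive (sym (ℚ.0≤p⇒∣p∣≡p 0≤p))
  ... | inj₂ p≤0 = ℚ.≤-trans p≤0 (ℚ.0≤∣p∣ p)

∣p-q∣<ε⇒q<ε+p : ∀ {p q ε} → ℚ.∣ p ℚ.- q ∣ ℚ.< ε → q ℚ.< ε ℚ.+ p
∣p-q∣<ε⇒q<ε+p {p} {q} {ε} ∣p-q∣<ε = ∣p-q∣<ε⇒p<ε+q
  (subst (ℚ._< ε) (trans (sym (ℚ.∣-p∣≡∣p∣ (p ℚ.- q))) (cong ℚ.∣_∣ -[p-q]≡q-p)) ∣p-q∣<ε)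
  where
  open +-*-Solver using (_:=_; _:+_; _:-_; :-_)
  -[p-q]≡q-p : ℚ.- (p ℚ.- q) ≡ q ℚ.- p
  -[p-q]≡q-p = +-*-Solver.solve 2 (λ p q → :- (p :- q) := q :- p) refl p q

-- One third of the gap for each error: the finitely many exceptions, and the deviations of two
-- classes from the common density.
∃-third : ∀ {p q} → p ℚ.< q → ∃[ ε ] 0ℚ ℚ.< ε × ε ℚ.+ (ε ℚ.+ (ε ℚ.+ p)) ≡ q
∃-third {p} {q} p<q = ε , 0<ε ,
  +-*-Solver.solve 2 (λ p q → let ε = (q :- p) :* con ⅓ in ε :+ (ε :+ (ε :+ p)) := q) refl p q
  where
  open +-*-Solver using (_:=_; _:+_; _:-_; _:*_; con)
  ⅓ = + 1 ℚ./ 3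
  ε = (q ℚ.- p) ℚ.* ⅓
  0<q-p : 0ℚ ℚ.< q ℚ.- p
  0<q-p = subst (ℚ._< q ℚ.- p) (ℚ.+-inverseʳ p) (ℚ.+-monoˡ-< (ℚ.- p) p<q)
  0<ε : 0ℚ ℚ.< ε
  0<ε = subst (ℚ._< ε) (ℚ.*-zeroˡ ⅓) (ℚ.*-monoˡ-<-pos ⅓ 0<q-p)

-- In the application `x` is the proportion of the set to be bounded, `y` that of its exceptions,
-- `z` that of the class containing the rest, `w` that of a sparse class, and `d` approximates the
-- common density.
3ε-bound : ∀ {q x y z w d c ε} → q ℚ.< x → x ℚ.≤ y ℚ.+ z → y ℚ.< ε →
           ℚ.∣ z ℚ.- d ∣ ℚ.< ε → ℚ.∣ w ℚ.- d ∣ ℚ.< ε → w ℚ.≤ c → q ℚ.< ε ℚ.+ (ε ℚ.+ (ε ℚ.+ c))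
3ε-bound {q} {x} {y} {z} {w} {d} {c} {ε} q<x x≤y+z y<ε z≈d w≈d w≤c = begin-strict
  q                             <⟨ q<x ⟩
  x                             ≤⟨ x≤y+z ⟩
  y ℚ.+ z                       <⟨ ℚ.+-mono-< y<ε (∣p-q∣<ε⇒p<ε+q z≈d) ⟩
  ε ℚ.+ (ε ℚ.+ d)               <⟨ ℚ.+-monoʳ-< ε (ℚ.+-monoʳ-< ε (∣p-q∣<ε⇒q<ε+p w≈d)) ⟩
  ε ℚ.+ (ε ℚ.+ (ε ℚ.+ w))       ≤⟨ ℚ.+-monoʳ-≤ ε (ℚ.+-monoʳ-≤ ε (ℚ.+-monoʳ-≤ ε w≤c)) ⟩
  ε ℚ.+ (ε ℚ.+ (ε ℚ.+ c))       ∎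
  where open ℚ.≤-Reasoning

-- Indices

size : ∀ {r} → Vec ℕ⁺ r → ℕ⁺
size []      = 1 , [ _ ]
size (l ∷ ℓ) = l *⁺ size ℓ

∏1/≡ratio-size : ∀ {r} (ℓ : Vec ℕ⁺ r) → ∏1/ ℓ ≡ ratio 1 (size ℓ)
∏1/≡ratio-size []      = refl
∏1/≡ratio-size (l ∷ ℓ) = trans (cong (ratio 1 l ℚ.*_) (∏1/≡ratio-size ℓ)) (ratio-* 1 1 l (size ℓ))

-- Mixed-radix encoding with the first coordinate most significant, so that `<` on ranks is the
-- lexicographic order.
rank : ∀ {r} {ℓ : Vec ℕ⁺ r} → Index ℓ → Fin (value (size ℓ))
rank {ℓ = []}    []       = zero
rank {ℓ = _ ∷ _} (i ∷ is) = combine i (rank is)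

unrank : ∀ {r} {ℓ : Vec ℕ⁺ r} → Fin (value (size ℓ)) → Index ℓ
unrank {ℓ = []}    _ = []
unrank {ℓ = l ∷ ℓ} a = let i , b = remQuot {value l} (value (size ℓ)) a in i ∷ unrank b

rank-unrank : ∀ {r} {ℓ : Vec ℕ⁺ r} (a : Fin (value (size ℓ))) → rank {ℓ = ℓ} (unrank a) ≡ a
rank-unrank {ℓ = []}    zero = refl
rank-unrank {ℓ = l ∷ ℓ} a    = trans
  (cong (combine (proj₁ (remQuot {value l} (value (size ℓ)) a))) (rank-unrank {ℓ = ℓ} _))
  (Fin.combine-remQuot {value l} (value (size ℓ)) a)

unrank-rank : ∀ {r} {ℓ : Vec ℕ⁺ r} (i : Index ℓ) → unrank (rank i) ≡ i
unrank-rank {ℓ = []}    []       = refl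
unrank-rank {ℓ = l ∷ ℓ} (i ∷ is) = cong₂ _∷_ (cong proj₁ eq) (trans (cong (unrank ∘ proj₂) eq) (unrank-rank is))
  where eq = Fin.remQuot-combine {value l} i (rank is)

at-extensional : ∀ {r} {ℓ : Vec ℕ⁺ r} {i j : Index ℓ} → (∀ k → i at k ≡ j at k) → i ≡ j
at-extensional {i = []}    {[]}    _   = refl
at-extensional {i = _ ∷ _} {_ ∷ _} i≗j = cong₂ _∷_ (i≗j zero) (at-extensional (i≗j ∘ suc))

combine-monoʳ-< : ∀ {m n} (i : Fin m) {a b : Fin n} → a Fin.< b → combine i a Fin.< combine i b
combine-monoʳ-< {n = n} i {a} {b} a<b = subst₂ ℕ._<_ (sym (Fin.toℕ-combine i a)) (sym (Fin.toℕ-combine i b))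
  (ℕ.+-monoʳ-< (n ℕ.* toℕ i) a<b)

-- Equal leading digits are peeled off, and at the first difference the leading digit outweighs all
-- later ones. The agreement hypothesis has the form that `¬∀⟶∃¬-smallest` supplies.
rank-mono-< : ∀ {r} {ℓ : Vec ℕ⁺ r} {i j : Index ℓ} (k : Fin r) →
              (∀ (k′ : Fin.Fin′ k) → i at (Fin.inject k′) ≡ j at (Fin.inject k′)) →
              (i at k) Fin.< (j at k) → rank i Fin.< rank j
rank-mono-< {i = _ ∷ _} {_ ∷ _} zero    _     i<j = Fin.combine-monoˡ-< _ _ i<j
rank-mono-< {ℓ = _ ∷ ℓ} {i ∷ is} {_ ∷ js} (suc k) agree i<j with refl ← agree zero =
  combine-monoʳ-< i (rank-mono-< {ℓ = ℓ} {is} {js} k (agree ∘ suc) i<j)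

-- Comparisons in Fin normalise to Boolean tests on ℕ, so with cannot abstract
-- the decision inside indexColour.
if-does⁻ : ∀ {P A : Set} (P? : Dec P) {x y z : A} →
           (if does P? then x else y) ≡ z → (P × x ≡ z) ⊎ (¬ P × y ≡ z)
if-does⁻ (yes p) eq = inj₁ (p , eq)
if-does⁻ (no ¬p) eq = inj₂ (¬p , eq)

-- Edge colours and the order of indices.

module _ {r} {ℓ : Vec ℕ⁺ r} (i j : Index ℓ) where

  -- This colour arises from equal indices or from an increase at the first difference, which is a
  -- lexicographic increase.
  indexColour-fromℕ : indexColour i j ≡ fromℕ r → rank i ≡ rank j ⊎ rank i Fin.< rank j
  indexColour-fromℕ eq with Fin.all? (λ k → (i at k) Fin.≟ (j at k))
  ... | yes i≗j = inj₁ (cong rank (at-extensional {i = i} {j} i≗j))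
  ... | no ¬i≗j with Fin.¬∀⟶∃¬-smallest r _ (λ k → (i at k) Fin.≟ (j at k)) ¬i≗j
  ...   | k , _ , agree with if-does⁻ ((i at k) Fin.<? (j at k)) eq
  ...     | inj₁ (i<j , _)   = inj₂ (rank-mono-< {i = i} {j} k agree i<j)
  ...     | inj₂ (_ , colour≡) = contradiction (sym colour≡) Fin.fromℕ≢inject₁

  -- The colour names the first differing coordinate; there the entries differ and the tail's is not
  -- the smaller one.
  indexColour-inject₁ : ∀ {k} → indexColour i j ≡ inject₁ k → (j at k) Fin.< (i at k)
  indexColour-inject₁ eq with Fin.all? (λ k → (i at k) Fin.≟ (j at k))
  ... | yes _   = contradiction eq Fin.fromℕ≢inject₁
  ... | no ¬i≗j with Fin.¬∀⟶∃¬-smallest r _ (λ k → (i at k) Fin.≟ (j at k)) ¬i≗j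
  ...   | k , i≢j , _ with if-does⁻ ((i at k) Fin.<? (j at k)) eq
  ...     | inj₁ (_ , colour≡)   = contradiction colour≡ Fin.fromℕ≢inject₁
  ...     | inj₂ (i≮j , colour≡) with refl ← Fin.inject₁-injective colour≡ = Fin.≤∧≢⇒< (ℕ.≮⇒≥ i≮j) (i≢j ∘ sym)

-- Density

range : ℕ⁺ → List ℕ⁺
range n = mapᴸ (λ m → suc m , [ _ ]) (upTo (value n))

length-range : ∀ n → length (range n) ≡ value n
length-range n = trans (length-map _ (upTo (value n))) (length-upTo (value n))

range-unique : ∀ n → Unique (range n)
range-unique n = Unique.map⁺ (ℕ.suc-injective ∘ cong value) (Unique.upTo⁺ (value n))

∈-range⁺ : ∀ m n → m ≤⁺ n → m ∈ᴸ range n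
∈-range⁺ (zero  , [ () ]) n
-- `suc m ≤ value n` is by definition `m < value n`, the bound for `upTo`, which starts at 0.
∈-range⁺ (suc m , [ _ ]) n m<n = ∈-map⁺ _ (∈-upTo⁺ m<n)

∈-range⁻ : ∀ {m} n → m ∈ᴸ range n → m ≤⁺ n
∈-range⁻ n m∈ with _ , m∈upTo , refl ← ∈-map⁻ _ m∈ = ∈-upTo⁻ m∈upTo

module _ {r} {ℓ : Vec ℕ⁺ r} (𝒰 : CubePartition ℓ) where

  open CubePartition 𝒰

  -- Membership in `U i` is an arbitrary predicate, but `partition` computes the index of every
  -- number. Its rank is decidable to compare, so classes can be listed by filtering.
  classOf : ℕ⁺ → Fin (value (size ℓ))
  classOf = rank ∘ indexOf

  class : Fin (value (size ℓ)) → ℕ⁺ → List ℕ⁺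
  class a n = fibre classOf (range n) a

  ∈U⇒classOf≡ : ∀ {m} a → m ∈ U (unrank a) → classOf m ≡ a
  ∈U⇒classOf≡ {m} a m∈U = trans (cong rank (proj₂ (proj₂ (partition m)) m∈U)) (rank-unrank {ℓ = ℓ} a)

  classOf≡⇒∈U : ∀ {m} a → classOf m ≡ a → m ∈ U (unrank a)
  classOf≡⇒∈U {m} a refl = subst (λ i → m ∈ U i) (sym (unrank-rank (indexOf m))) (proj₁ (proj₂ (partition m)))

  ∈-class⁺ : ∀ m n {a} → m ≤⁺ n → classOf m ≡ a → m ∈ᴸ class a n
  ∈-class⁺ m n {a} m≤n = ∈-filter⁺ (λ m → classOf m Fin.≟ a) (∈-range⁺ m n m≤n)

  -- `HasDensity` speaks of exact counts only; this provides the count to which the density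
  -- hypothesis is applied.
  length-class : ∀ a n → ∣ U (unrank a) ∩[1‥ n ]∣≡ length (class a n)
  length-class a n =
    ( class a n
    , Unique.filter⁺ (λ m → classOf m Fin.≟ a) (range-unique n)
    , Allᴸ.tabulate (λ m∈ →
        let m∈range , eq = ∈-filter⁻ (λ m → classOf m Fin.≟ a) {xs = range n} m∈
        in classOf≡⇒∈U a eq , ∈-range⁻ n m∈range)
    , refl )
    , λ { _ (xs , xs! , xs⊆U , refl) → Unique-⊆⇒length-≤ xs! λ {x} x∈xs →
          let x∈U , x≤n = Allᴸ.lookup xs⊆U x∈xs in ∈-class⁺ x n x≤n (∈U⇒classOf≡ a x∈U) }

  ∃-sparse-class : ∀ n → ∃[ a ] ratio (length (class a n)) n ℚ.≤ ratio 1 (size ℓ)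
  ∃-sparse-class n with a , L*∣a∣≤n ← ∃-small-fibre classOf {{value-nonZero (size ℓ)}} (range n) =
    a , ratio-≤ (length (class a n)) 1 n (size ℓ) (begin
      length (class a n) ℕ.* value (size ℓ)  ≡⟨ ℕ.*-comm (length (class a n)) _ ⟩
      value (size ℓ) ℕ.* length (class a n)  ≤⟨ L*∣a∣≤n ⟩
      length (range n)                       ≡⟨ length-range n ⟩
      value n                                ≡⟨ ℕ.*-identityˡ (value n) ⟨
      1 ℕ.* value n                          ∎)
    where open ℕ.≤-Reasoning

  -- At a large `n` the proportion of `A` exceeds that of class `a` by little, class `a` is about as
  -- dense as every other class, and some class has proportion at most `ratio 1 (size ℓ)`.
  almostInClass⇒density-≤ : EquallyDense 𝒰 → ∀ {A : Pred ℕ⁺ 0ℓ} ys a →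
    (∀ {m} → m ∈ A → m ∈ᴸ ys ⊎ classOf m ≡ a) → UpperDensity A AtMost ratio 1 (size ℓ)
  almostInClass⇒density-≤ (d , dense) {A} ys a A⊆ q q∈ = ℚ.≮⇒≥ λ c<q →
    let ε , 0<ε , 3ε+c≡q = ∃-third c<q
        N₁ , ys-sparse = ratio-eventually-< (length ys) 0<ε
        -- The sparse class `b` depends on `n`, so the threshold must serve all classes at once.
        N₂ , dense≤N₂  = ∃-upperBound (λ b → value (proj₁ (dense (unrank b) ε 0<ε)))
        n , N≤n , _ , A-dense , q<ratio = q∈ (suc (N₁ ⊔ N₂) , [ _ ])
        b , b-sparse = ∃-sparse-class n
        close : ∀ b → ℚ.∣ ratio (length (class b n)) n ℚ.- ℝ.approx d n ∣ ℚ.< ε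
        close b = proj₂ (dense (unrank b) ε 0<ε) n
          (ℕ.≤-trans (dense≤N₂ b) (ℕ.≤-trans (ℕ.m≤n⇒m≤1+n (ℕ.m≤n⊔m N₁ N₂)) N≤n)) _ (length-class b n)
    -- The bound reads `q < 3ε + c`, while ε was chosen with `3ε + c` equal to `q`.
    in ℚ.<-irrefl (sym 3ε+c≡q)
      (3ε-bound q<ratio (ratio-A n A-dense) (ys-sparse n (ℕ.≤-trans (ℕ.m≤n⇒m≤1+n (ℕ.m≤m⊔n N₁ N₂)) N≤n))
        (close a) (close b) b-sparse)
    where
    ratio-A : ∀ n {k} → ∣ A ∩[1‥ n ]∣≥ k → ratio k n ℚ.≤ ratio (length ys) n ℚ.+ ratio (length (class a n)) n
    ratio-A n (xs , xs! , xs⊆A , refl) = ℚ.≤-trans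
      (ratio-monoˡ-≤ n (ℕ.≤-trans (Unique-⊆⇒length-≤ xs! xs⊆) (ℕ.≤-reflexive (length-++ ys))))
      (ℚ.≤-reflexive (ratio-+ (length ys) (length (class a n)) n))
      where
      xs⊆ : xs ⊆ ys ++ class a n
      xs⊆ {x} x∈xs with x∈A , x≤n ← Allᴸ.lookup xs⊆A x∈xs =
        [ ∈-++⁺ˡ , ∈-++⁺ʳ ys ∘ ∈-class⁺ x n x≤n ]′ (A⊆ x∈A)

  -- Paths

  -- Coordinate `i` strictly decreases along every edge of this colour, but the path has one vertex
  -- more than the coordinate has values. In a backward path the coordinate increases with the
  -- position.
  no-path : ∀ i (p : DirectedPath (finite (value (lookup ℓ i)))) → ¬ Monochromatic (cubeColouring 𝒰) (inject₁ i) p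
  no-path i record { vertex = vertex ; orientation = forward } mono =
    no-long-chain Fin._>_ (λ i>j j>k → ℕ.<-trans j>k i>j) (λ { refl → ℕ.<-irrefl refl })
      (λ u → indexOf (vertex u) at i)
      (λ u v u→v → indexColour-inject₁ (indexOf (vertex u)) (indexOf (vertex v)) (mono u v u→v))
  no-path i record { vertex = vertex ; orientation = backward } mono =
    no-long-chain Fin._<_ ℕ.<-trans Fin.<-irrefl
      (λ u → indexOf (vertex u) at i)
      (λ u v u→v → indexColour-inject₁ (indexOf (vertex v)) (indexOf (vertex u)) (mono u v u→v))

  -- Ranks are weakly increasing along a forward path and weakly decreasing along a backward one; on
  -- a finite set both `>` and `<` are well-founded.
  ¬¬-classOf-eventuallyConstant : (p : DirectedPath infinite) → Monochromatic (cubeColouring 𝒰) (fromℕ r) p →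
    let x = classOf ∘ DirectedPath.vertex p in ¬ ¬ (∃[ m ] (∀ d → x (d ℕ.+ m) ≡ x m))
  ¬¬-classOf-eventuallyConstant record { vertex = vertex ; orientation = forward } mono =
    ¬¬-eventuallyConstant Fin.>-wellFounded (classOf ∘ vertex)
      (λ n → Sum.map₁ sym (indexColour-fromℕ (indexOf (vertex n)) (indexOf (vertex (suc n))) (mono n (suc n) refl)))
  ¬¬-classOf-eventuallyConstant record { vertex = vertex ; orientation = backward } mono =
    ¬¬-eventuallyConstant Fin.<-wellFounded (classOf ∘ vertex)
      (λ n → indexColour-fromℕ (indexOf (vertex (suc n))) (indexOf (vertex n)) (mono n (suc n) refl))

  ¬¬-almostInClass : ∀ {len} (p : DirectedPath len) → Monochromatic (cubeColouring 𝒰) (fromℕ r) p →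
    ¬ ¬ (∃₂ λ ys a → ∀ {m} → m ∈ DirectedPath.vertexSet p → m ∈ᴸ ys ⊎ classOf m ≡ a)
  ¬¬-almostInClass {finite n} p _ ¬almost = ¬almost
    -- All vertices of a finite path count as exceptions, so any class would do.
    (mapᴸ vertex (allFin (suc n)) , classOf (vertex zero) , λ { (u , refl) → inj₁ (∈-map⁺ vertex (∈-allFin u)) })
    where open DirectedPath p
  ¬¬-almostInClass {infinite} p mono ¬almost = ¬¬-classOf-eventuallyConstant p mono λ (m , constant) → ¬almost
    ( mapᴸ vertex (upTo m)
    , classOf (vertex m)
    , λ { (u , refl) → [ (λ u<m → inj₁ (∈-map⁺ vertex (∈-upTo⁺ u<m)))
                       -- Constancy is stated at positions `d ℕ.+ m`; here `d` is `u ℕ.∸ m`.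
                       , (λ m≤u → inj₂ (subst (λ u → classOf (vertex u) ≡ classOf (vertex m))
                                               (ℕ.m∸n+n≡m m≤u) (constant (u ℕ.∸ m)))) ]′
                       (ℕ.<-≤-connex u m) } )
    where open DirectedPath p

theorem3p6 : ∀ {r : ℕ} (ℓ : Vec ℕ⁺ r) (𝒰 : CubePartition ℓ) → EquallyDense 𝒰 →
    (∀ (i : Fin r) (p : DirectedPath (finite (value (lookup ℓ i)))) → ¬ Monochromatic (cubeColouring 𝒰) (inject₁ i) p)
    × (∀ {len : Length} (p : DirectedPath len) → Monochromatic (cubeColouring 𝒰) (fromℕ r) p → UpperDensity (DirectedPath.vertexSet p) AtMost (∏1/ ℓ))
theorem3p6 ℓ 𝒰 dense = no-path 𝒰 , λ p mono q q∈ → decidable-stable (q ℚ.≤? ∏1/ ℓ) λ q≰ →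
  ¬¬-almostInClass 𝒰 p mono λ (ys , a , V⊆) →
    q≰ (subst (q ℚ.≤_) (sym (∏1/≡ratio-size ℓ)) (almostInClass⇒density-≤ 𝒰 dense ys a V⊆ q q∈))
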